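{- Let $k \ge 2$. For any $n, m \in \mathbb{N}$ with $1 \le m \le n$, we have $n - o_n(m) = \mathcal{G}(nk - m)$.
   Context: Josephus problem: the numbers $1,2,\dots,n$ are arranged in a circle; starting the count at $1$, every $k$-th number still present is removed (counting resumes with the next remaining number after each removal) until one number remains. For $1 \le m \le n$, $o_n(m)=i$ if $m$ is the $i$-th number removed ($1 \le i \le n-1$), and $o_n(m)=n$ if $m$ is the number that remains. Maximum Nim with rule function $f(x)=\lfloor x/k\rfloor$: a position is a pile of $x \ge 0$ stones, and from $x$ one may move to $x-u$ for any integer $u$ with $1 \le u \le \lfloor x/k \rfloor$. The Grundy number is defined recursively by $\mathcal{G}(x) = \mathrm{mex}\{\mathcal{G}(x-u) : 1 \le u \le \lfloor x/k\rfloor\}$, where $\mathrm{mex}(S)$ is the least non-negative integer not in $S$ (so $\mathcal{G}(x)=0$ when $\lfloor x/k\rfloor = 0$). -}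

module Defs where

open import Data.Fin.Base using (Fin; zero; suc; toℕ; fromℕ<)
open import Data.Fin.Properties using (toℕ<n; toℕ-injective; toℕ-fromℕ<; injective⇒≤)
open import Data.List.Base as List using (List; length)
open import Data.List.Membership.Propositional as List using ()
open import Data.List.Membership.Setoid.Properties using (index-injective)
open import Data.List.Properties using (tabulate-cong)
open import Data.List.Relation.Unary.Any as List using ()
open import Data.Nat.Base using (ℕ; zero; suc; pred; _+_; _∸_; _≤_; _<_; z≤n; s≤s; NonZero)
open import Data.Nat.DivMod using (_/_; m/n≤m)
open import Data.Nat.GeneralisedArithmetic using (iterate)
open import Data.Nat.Induction using (<-rec; <-wellFounded)
open import Data.Nat.Properties using (_≟_; ≤-trans; m<1+n⇒m<n∨m≡n; ∸-monoʳ-<; +-suc; +-identityʳ; 1+n≰n)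
open import Data.Sum.Base using (inj₁; inj₂)
open import Data.Vec.Base using (Vec; []; _∷_; _∷ʳ_; head; tail; tabulate; lookup)
open import Data.Vec.Membership.Propositional using (_∈_)
open import Data.Vec.Membership.Propositional.Properties using (∈-tabulate⁺)
open import Data.Vec.Relation.Unary.Any using (here; there)
open import Data.Product.Base using (∃; _×_; _,_)
open import Function.Base using (_∘_)
open import Induction.WellFounded using (WfRec; module FixPoint)
open import Relation.Binary.PropositionalEquality using (_≡_; refl; sym; trans; cong; subst; setoid)
open import Relation.Nullary using (¬_; yes; no; contradiction)

open import Data.List.Membership.DecPropositional _≟_ using (_∈?_)

private
  variable
    n : ℕ

-- A circle is listed from the number that is counted next, in counting
-- order; to count a number without removing it is to move it to the end.
rotate : Vec ℕ (suc n) → Vec ℕ (suc n)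
rotate (x ∷ xs) = xs ∷ʳ x

-- The numbers in the order of their removal, followed by the one that
-- remains.  The k-th number counted is the head after pred k rotations.
removalOrder : ℕ → Vec ℕ n → Vec ℕ n
removalOrder k []               = []
removalOrder k (x ∷ [])         = x ∷ []
removalOrder k xs@(_ ∷ _ ∷ _)   = head ys ∷ removalOrder k (tail ys)
  where ys = iterate rotate xs (pred k)

circle : ∀ n → Vec ℕ n
circle n = tabulate (suc ∘ toℕ)

-- The 1-based position of the first occurrence.  The value when there is
-- no occurrence is irrelevant: see o-spec.
position : ℕ → Vec ℕ n → ℕ
position m []       = 0
position m (x ∷ xs) with m ≟ x
... | yes _ = 1
... | no  _ = suc (position m xs)

o : (k n m : ℕ) → ℕ
o k n m = position m (removalOrder k (circle n))

private
  ∈-∷ʳ⁺ˡ : ∀ {m x} {xs : Vec ℕ n} → m ∈ xs → m ∈ xs ∷ʳ x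
  ∈-∷ʳ⁺ˡ (here eq)  = here eq
  ∈-∷ʳ⁺ˡ (there m∈) = there (∈-∷ʳ⁺ˡ m∈)

  ∈-∷ʳ⁺ʳ : ∀ {m x} (xs : Vec ℕ n) → m ≡ x → m ∈ xs ∷ʳ x
  ∈-∷ʳ⁺ʳ []       eq = here eq
  ∈-∷ʳ⁺ʳ (_ ∷ xs) eq = there (∈-∷ʳ⁺ʳ xs eq)

  ∈-rotate : ∀ {m} (xs : Vec ℕ (suc n)) → m ∈ xs → m ∈ rotate xs
  ∈-rotate (x ∷ xs) (here eq)  = ∈-∷ʳ⁺ʳ xs eq
  ∈-rotate (x ∷ xs) (there m∈) = ∈-∷ʳ⁺ˡ m∈

  ∈-iterate : ∀ {m} j (xs : Vec ℕ (suc n)) → m ∈ xs → m ∈ iterate rotate xs j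
  ∈-iterate zero    xs m∈ = m∈
  ∈-iterate (suc j) xs m∈ = ∈-iterate j (rotate xs) (∈-rotate xs m∈)

  ∈-head∷ : ∀ {m j} (xs : Vec ℕ (suc n)) {ys : Vec ℕ j} → m ∈ xs →
            (m ∈ tail xs → m ∈ ys) → m ∈ head xs ∷ ys
  ∈-head∷ (x ∷ xs) (here eq)  f = here eq
  ∈-head∷ (x ∷ xs) (there m∈) f = there (f m∈)

  ∈-removalOrder : ∀ {m} k (xs : Vec ℕ n) → m ∈ xs → m ∈ removalOrder k xs
  ∈-removalOrder k (x ∷ []) m∈ = m∈
  ∈-removalOrder k xs@(_ ∷ _ ∷ _) m∈ =
    ∈-head∷ (iterate rotate xs (pred k)) (∈-iterate (pred k) xs m∈)
      (∈-removalOrder k (tail (iterate rotate xs (pred k))))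

  position-spec : ∀ {m} (xs : Vec ℕ n) → m ∈ xs →
                  ∃ λ i → position m xs ≡ suc (toℕ i) × lookup xs i ≡ m
  position-spec {m = m} (x ∷ xs) m∈ with m ≟ x
  position-spec (x ∷ xs) m∈         | yes m≡x = zero , refl , sym m≡x
  position-spec (x ∷ xs) (here m≡x) | no m≢x  = contradiction m≡x m≢x
  position-spec (x ∷ xs) (there m∈) | no m≢x  with position-spec xs m∈
  ... | i , pos≡ , look≡ = suc i , cong suc pos≡ , look≡

o-spec : ∀ k n m → 1 ≤ m → m ≤ n →
         ∃ λ (i : Fin n) → o k n m ≡ suc (toℕ i) × lookup (removalOrder k (circle n)) i ≡ m
o-spec k n (suc m) 1≤m m<n =
  position-spec _ (∈-removalOrder k (circle n)
    (subst (_∈ circle n) (cong suc (toℕ-fromℕ< m<n))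
      (∈-tabulate⁺ (suc ∘ toℕ) (fromℕ< m<n))))

-- Searches upwards from g, through at most the given number of candidates.
mexFrom : (fuel g : ℕ) → List ℕ → ℕ
mexFrom zero       g S = g
mexFrom (suc fuel) g S with g ∈? S
... | yes _ = mexFrom fuel (suc g) S
... | no  _ = g

-- The numbers 0, …, length S cannot all occur in S, so the search does not
-- stop early: see mex-∉ and <mex⇒∈.
mex : List ℕ → ℕ
mex S = mexFrom (length S) 0 S

private
  extend : ∀ {g S} → (∀ {h} → h < g → h List.∈ S) → g List.∈ S →
           ∀ {h} → h < suc g → h List.∈ S
  extend below g∈ h<1+g with m<1+n⇒m<n∨m≡n h<1+g
  ... | inj₁ h<g  = below h<g
  ... | inj₂ refl = g∈

  full⇒≤length : ∀ {g S} → (∀ {h} → h < g → h List.∈ S) → g ≤ length S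
  full⇒≤length {S = S} below = injective⇒≤ {f = λ i → List.index (below (toℕ<n i))}
    λ {i} {j} eq → toℕ-injective
      (index-injective (setoid ℕ) (below (toℕ<n i)) (below (toℕ<n j)) eq)

  mexFrom-∉ : ∀ fuel g S → (∀ {h} → h < g → h List.∈ S) → fuel + g ≡ length S →
              ¬ (mexFrom fuel g S List.∈ S)
  mexFrom-∉ zero g S below refl g∈ = 1+n≰n (full⇒≤length (extend below g∈))
  mexFrom-∉ (suc fuel) g S below eq with g ∈? S
  ... | yes g∈ = mexFrom-∉ fuel (suc g) S (extend below g∈) (trans (+-suc fuel g) eq)
  ... | no  g∉ = g∉

  <mexFrom⇒∈ : ∀ fuel g S → (∀ {h} → h < g → h List.∈ S) →
               ∀ {h} → h < mexFrom fuel g S → h List.∈ S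
  <mexFrom⇒∈ zero       g S below = below
  <mexFrom⇒∈ (suc fuel) g S below with g ∈? S
  ... | yes g∈ = <mexFrom⇒∈ fuel (suc g) S (extend below g∈)
  ... | no  _  = below

mex-∉ : ∀ S → ¬ (mex S List.∈ S)
mex-∉ S = mexFrom-∉ (length S) 0 S (λ ()) (+-identityʳ (length S))

<mex⇒∈ : ∀ S {h} → h < mex S → h List.∈ S
<mex⇒∈ S = <mexFrom⇒∈ (length S) 0 S (λ ())

module _ (k : ℕ) .{{_ : NonZero k}} where

  move-< : ∀ x (i : Fin (x / k)) → x ∸ suc (toℕ i) < x
  move-< x i = ∸-monoʳ-< (s≤s z≤n) (≤-trans (toℕ<n i) (m/n≤m x k))

  private
    step : ∀ x → WfRec _<_ (λ _ → ℕ) x → ℕ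
    step x rec = mex (List.tabulate λ i → rec (move-< x i))

  𝒢 : ℕ → ℕ
  𝒢 = <-rec (λ _ → ℕ) step

  -- As i ranges over Fin (x / k), suc (toℕ i) ranges over 1, …, ⌊ x / k ⌋.
  𝒢-rec : ∀ x → 𝒢 x ≡ mex (List.tabulate {n = x / k} λ i → 𝒢 (x ∸ suc (toℕ i)))
  𝒢-rec x = FixPoint.unfold-wfRec <-wellFounded (λ _ → ℕ) step
    (λ x eq → cong mex (tabulate-cong λ i → eq (move-< x i)))

{-# OPTIONS --safe #-}
-- Both sides obey the same one-step recursion.  Let a circle of q + 1 numbers
-- be listed from the number counted next, with c more numbers to be counted
-- before the next removal; then a number with p numbers before it should be
-- assigned 𝒢 (c + q k − p).  Counting a number lowers both c and p by one,
-- except that the head of the circle goes from p = 0 to p = q; this is matched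
-- by 𝒢 (q k + c + 1) = 𝒢 (q k + c − q) for c + 1 < k.  A removed number has
-- c = p = 0 and is matched by 𝒢 (q k) = q.
module Submission where

open import Defs
open import Data.Fin.Base using (Fin; zero; suc; toℕ; fromℕ<)
open import Data.Fin.Properties using (toℕ-fromℕ<; toℕ-injective; suc-injective; 0≢1+n)
open import Data.List.Base as List using (List)
open import Data.List.Membership.Propositional using (_∈_)
open import Data.List.Membership.Propositional.Properties using (∈-tabulate⁺)
open import Data.List.Properties using (length-tabulate)
open import Data.Nat.Base using (ℕ; zero; suc; pred; _+_; _*_; _∸_; _≤_; _<_; z≤n; s≤s; NonZero)
open import Data.Nat.DivMod using (_/_; m<n⇒m/n≡0; m*n/n≡m; +-distrib-/-∣ʳ)
open import Data.Nat.Divisibility using (n∣m*n)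
open import Data.Nat.GeneralisedArithmetic using (iterate)
open import Data.Nat.Properties
  using (_≟_; ≤-refl; ≤-trans; ≤-reflexive; n≤1+n; m≤n+m; m≤n⇒m<n∨m≡n; +-suc; +-identityʳ)
open import Data.Product.Base using (∃; _×_; _,_)
open import Data.Sum.Base using (inj₁; inj₂)
open import Data.Vec.Base using (Vec; []; _∷_; _∷ʳ_; head; tail; tabulate)
open import Data.Vec.Relation.Unary.All using (All; []; _∷_)
open import Data.Vec.Relation.Unary.All.Properties using (tabulate⁺)
open import Function.Base using (_∘_)
open import Function.Definitions using (Injective)
open import Relation.Binary.PropositionalEquality
  using (_≡_; _≢_; refl; sym; trans; cong; cong₂; subst; subst₂)
open import Relation.Nullary using (yes; no; contradiction)

open import Data.List.Membership.DecPropositional _≟_ using (_∈?_)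

private
  variable
    n m p x : ℕ

mexFrom≤ : ∀ fuel g S → mexFrom fuel g S ≤ fuel + g
mexFrom≤ zero       g S = ≤-refl
mexFrom≤ (suc fuel) g S with g ∈? S
... | yes _ = ≤-trans (mexFrom≤ fuel (suc g) S) (≤-reflexive (+-suc fuel g))
... | no  _ = m≤n+m g (suc fuel)

mex≤length : ∀ S → mex S ≤ List.length S
mex≤length S = ≤-trans (mexFrom≤ (List.length S) 0 S) (≤-reflexive (+-identityʳ _))

module _ (k : ℕ) .{{_ : NonZero k}} where

  options : ℕ → List ℕ
  options x = List.tabulate {n = x / k} λ i → 𝒢 k (x ∸ suc (toℕ i))

  𝒢≤/ : ∀ x → 𝒢 k x ≤ x / k
  𝒢≤/ x = subst₂ _≤_ (sym (𝒢-rec k x)) (length-tabulate _) (mex≤length (options x))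

  𝒢-move∈options : ∀ x {i} → i < x / k → 𝒢 k (x ∸ suc i) ∈ options x
  𝒢-move∈options x i<x/k = subst (λ j → 𝒢 k (x ∸ suc j) ∈ options x) (toℕ-fromℕ< i<x/k)
    (∈-tabulate⁺ (fromℕ< i<x/k))

  𝒢≢𝒢-move : ∀ x {i} → i < x / k → 𝒢 k x ≢ 𝒢 k (x ∸ suc i)
  𝒢≢𝒢-move x i<x/k eq = mex-∉ (options x)
    (subst (_∈ options x) (trans (sym eq) (𝒢-rec k x)) (𝒢-move∈options x i<x/k))

  [r+q*k]/k≡q : ∀ {r} q → r < k → (r + q * k) / k ≡ q
  [r+q*k]/k≡q {r} q r<k = trans (+-distrib-/-∣ʳ r (n∣m*n q))
    (cong₂ _+_ (m<n⇒m/n≡0 r<k) (m*n/n≡m q k))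

  -- For `q ≤ x` this concerns the window of pile sizes `x ∸ q, …, x`. It has as many sizes as there
  -- are values to hit, so by pigeonhole the Grundy values on it are a permutation of `0, …, q`.
  Covers : ℕ → ℕ → Set
  Covers q x = ∀ {h} → h ≤ q → ∃ λ i → i ≤ q × 𝒢 k (x ∸ i) ≡ h

  -- 𝒢 (suc x) differs from the values at its options, so if 0, …, q are covered
  -- at x, it can only be the one value not covered by an option.
  𝒢-suc-shift : ∀ {q x} → suc x / k ≡ q → Covers q x → 𝒢 k (suc x) ≡ 𝒢 k (x ∸ q)
  𝒢-suc-shift {x = x} refl covers with covers (𝒢≤/ (suc x))
  ... | i , i≤q , eq with m≤n⇒m<n∨m≡n i≤q
  ...   | inj₁ i<q  = contradiction (sym eq) (𝒢≢𝒢-move (suc x) i<q)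
  ...   | inj₂ refl = sym eq

  -- The moves from `suc x` reach exactly the window covered at `x`, which rules out `0, …, q`; the
  -- bound `𝒢≤/` then leaves only `suc q`.
  𝒢-suc-jump : ∀ {q x} → suc x / k ≡ suc q → Covers q x → 𝒢 k (suc x) ≡ suc q
  𝒢-suc-jump {x = x} x/k≡ covers with m≤n⇒m<n∨m≡n (subst (𝒢 k (suc x) ≤_) x/k≡ (𝒢≤/ (suc x)))
  ... | inj₂ eq = eq
  ... | inj₁ (s≤s 𝒢≤q) with covers 𝒢≤q
  ...   | i , i≤q , eq =
    contradiction (sym eq) (𝒢≢𝒢-move (suc x) (subst (i <_) (sym x/k≡) (s≤s i≤q)))

  -- The window slides: `x ∸ q` drops out, `suc x` enters with the same value, and every other index
  -- rises by one.
  covers-shift : ∀ {q x} → 𝒢 k (suc x) ≡ 𝒢 k (x ∸ q) → Covers q x → Covers q (suc x)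
  covers-shift eq covers h≤q with covers h≤q
  ... | i , i≤q , 𝒢≡h with m≤n⇒m<n∨m≡n i≤q
  ...   | inj₁ i<q  = suc i , i<q , 𝒢≡h
  ...   | inj₂ refl = 0 , z≤n , trans eq 𝒢≡h

  -- The window grows instead of sliding: all old sizes stay, and `suc x` supplies the one new
  -- value.
  covers-jump : ∀ {q x} → 𝒢 k (suc x) ≡ suc q → Covers q x → Covers (suc q) (suc x)
  covers-jump eq covers h≤1+q with m≤n⇒m<n∨m≡n h≤1+q
  ... | inj₂ refl = 0 , z≤n , eq
  ... | inj₁ (s≤s h≤q) with covers h≤q
  ...   | i , i≤q , 𝒢≡h = suc i , s≤s i≤q , 𝒢≡h

module _ (k′ : ℕ) where

  private
    k = suc k′

  -- Induction on the pile, one stone at a time: the window slides while the quotient by `k` stays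
  -- at `q`, and grows at each positive multiple of `k`.
  covers : ∀ q r → r < k → Covers k q (r + q * k)
  covers zero    zero    _   z≤n = 0 , z≤n , refl
  covers (suc q) zero    r<k =
    -- `suc q * k` reduces to `suc (k′ + q * k)`, so its predecessor has quotient `q` and the
    -- largest remainder, `k′`.
    covers-jump k (𝒢-suc-jump k ([r+q*k]/k≡q k (suc q) r<k) below) below
    where below = λ {h} → covers q k′ ≤-refl {h}
  covers q       (suc r) r<k =
    covers-shift k (𝒢-suc-shift k ([r+q*k]/k≡q k q r<k) below) below
    where below = λ {h} → covers q r (≤-trans (n≤1+n _) r<k) {h}

  𝒢-multiple : ∀ q → 𝒢 k (q * k) ≡ q
  𝒢-multiple zero    = refl
  𝒢-multiple (suc q) = 𝒢-suc-jump k ([r+q*k]/k≡q k (suc q) (s≤s z≤n)) (covers q k′ ≤-refl)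

  𝒢-periodic : ∀ q r → suc r < k → 𝒢 k (suc r + q * k) ≡ 𝒢 k (r + q * k ∸ q)
  𝒢-periodic q r r<k =
    𝒢-suc-shift k ([r+q*k]/k≡q k q r<k) (covers q r (≤-trans (n≤1+n _) r<k))

-- Absence of `m` from the rest is recorded because rotating `m` to the end puts those entries in
-- front of it, and `position` reports the first occurrence.
data OnlyAt (m : ℕ) : ℕ → Vec ℕ n → Set where
  here  : {xs : Vec ℕ n} → All (m ≢_) xs → OnlyAt m 0 (m ∷ xs)
  there : {xs : Vec ℕ n} → m ≢ x → OnlyAt m p xs → OnlyAt m (suc p) (x ∷ xs)

onlyAt-last : {xs : Vec ℕ n} → All (m ≢_) xs → OnlyAt m n (xs ∷ʳ m)
onlyAt-last []           = here []
onlyAt-last (m≢x ∷ m≢xs) = there m≢x (onlyAt-last m≢xs)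

all-∷ʳ : {xs : Vec ℕ n} → All (m ≢_) xs → m ≢ x → All (m ≢_) (xs ∷ʳ x)
all-∷ʳ []           m≢x = m≢x ∷ []
all-∷ʳ (m≢y ∷ m≢xs) m≢x = m≢y ∷ all-∷ʳ m≢xs m≢x

onlyAt-∷ʳ : {xs : Vec ℕ n} → OnlyAt m p xs → m ≢ x → OnlyAt m p (xs ∷ʳ x)
onlyAt-∷ʳ (here m≢xs)    m≢x = here (all-∷ʳ m≢xs m≢x)
onlyAt-∷ʳ (there m≢y at) m≢x = there m≢y (onlyAt-∷ʳ at m≢x)

onlyAt-tabulate : (f : Fin n → ℕ) → Injective _≡_ _≡_ f →
                  ∀ i → OnlyAt (f i) (toℕ i) (tabulate f)
onlyAt-tabulate f inj zero    = here (tabulate⁺ λ j eq → 0≢1+n (inj eq))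
onlyAt-tabulate f inj (suc i) = there (λ eq → 0≢1+n (sym (inj eq)))
  (onlyAt-tabulate (f ∘ suc) (suc-injective ∘ inj) i)

position-∷-≡ : ∀ m (xs : Vec ℕ n) → position m (m ∷ xs) ≡ 1
position-∷-≡ m xs with m ≟ m
... | yes _  = refl
... | no m≢m = contradiction refl m≢m

position-∷-≢ : (xs : Vec ℕ n) → m ≢ x → position m (x ∷ xs) ≡ suc (position m xs)
position-∷-≢ {m = m} {x = x} xs m≢x with m ≟ x
... | yes m≡x = contradiction m≡x m≢x
... | no _    = refl

-- Only the first removal waits for `c` counts; later ones wait for `pred k`. Freeing `c` allows
-- induction on single counts.
removeAfter : ℕ → ℕ → Vec ℕ (suc n) → Vec ℕ (suc n)
removeAfter k c xs = head ys ∷ removalOrder k (tail ys)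
  where ys = iterate rotate xs c

removeAfter-[-] : ∀ k c x → removeAfter k c (x ∷ []) ≡ x ∷ []
removeAfter-[-] k zero    x = refl
removeAfter-[-] k (suc c) x = removeAfter-[-] k c x

removalOrder≡removeAfter : ∀ k (xs : Vec ℕ (suc n)) → removalOrder k xs ≡ removeAfter k (pred k) xs
removalOrder≡removeAfter k (x ∷ [])    = sym (removeAfter-[-] k (pred k) x)
removalOrder≡removeAfter k (_ ∷ _ ∷ _) = refl

module _ (k′ : ℕ) where

  private
    k = suc k′

  position-removeAfter : ∀ q c {xs : Vec ℕ (suc q)} → c < k → OnlyAt m p xs →
                         suc q ∸ position m (removeAfter k c xs) ≡ 𝒢 k (c + q * k ∸ p)
  position-removeAfter {m = m} q zero {_ ∷ xs} _ (here _) =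
    trans (cong (suc q ∸_) (position-∷-≡ m (removalOrder k xs))) (sym (𝒢-multiple k′ q))
  -- After the head is removed the count restarts at `k′`; `suc q * k ∸ suc p` reduces to
  -- `k′ + q * k ∸ p`, as the smaller circle requires.
  position-removeAfter {m = m} (suc q) zero {_ ∷ xs} _ (there m≢x at) =
    trans (cong (suc (suc q) ∸_) (position-∷-≢ (removalOrder k xs) m≢x))
      (trans (cong (λ ys → suc q ∸ position m ys) (removalOrder≡removeAfter k xs))
        (position-removeAfter q k′ ≤-refl at))
  -- The counted head now has `q` numbers before it, so the induction hypothesis gives
  -- `𝒢 k (c + q * k ∸ q)`.
  position-removeAfter q (suc c) c<k (here m≢xs) =
    trans (position-removeAfter q c (≤-trans (n≤1+n _) c<k) (onlyAt-last m≢xs))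
      (sym (𝒢-periodic k′ q c c<k))
  -- Both successors cancel in `suc c + q * k ∸ suc p`, so the induction hypothesis has the required
  -- type.
  position-removeAfter q (suc c) c<k (there m≢x at) =
    position-removeAfter q c (≤-trans (n≤1+n _) c<k) (onlyAt-∷ʳ at m≢x)

onlyAt-circle : m < n → OnlyAt (suc m) m (circle n)
onlyAt-circle m<n = subst (λ j → OnlyAt (suc j) j (circle _)) (toℕ-fromℕ< m<n)
  (onlyAt-tabulate (suc ∘ toℕ) (toℕ-injective ∘ cong pred) (fromℕ< m<n))

theorem2 : (k : ℕ) .{{_ : NonZero k}} → 2 ≤ k → (n m : ℕ) → 1 ≤ m → m ≤ n → n ∸ o k n m ≡ 𝒢 k (n * k ∸ m)
theorem2 k@(suc k′) _ n@(suc q) (suc m) _ m<n =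
  -- At the start `k′` numbers are counted before the first removal and `suc m` has `m` numbers
  -- before it; `n * k ∸ suc m` reduces to `k′ + q * k ∸ m`.
  trans (cong (λ ys → n ∸ position (suc m) ys) (removalOrder≡removeAfter k (circle n)))
    (position-removeAfter k′ q k′ ≤-refl (onlyAt-circle m<n))
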